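{- In the sequent system $\mathbf{LJK}$, for all formulas $a_1,\dots,a_n$ and $b$ and every term $G$ built from the symbols "$,$", $\circ_2,\bullet_2,\circ_\alpha,\epsilon$ such that there exists a deduction of $G(a_1,\dots,a_n)\vdash b$ using the cut rule (i.e. in $\mathbf{LJK}$ augmented with the cut rule), there exists a deduction of $G(a_1,\dots,a_n)\vdash b$ not using the cut rule.
   Context: **Syntax.** Formulas are built from propositional variables by the constant $\underline 0$, the binary symbols $\dot+,\dot-,\wedge,\vee$ and the unary symbols $2,\frac{\cdot}{2},j_*,j,\alpha,\blacksquare_\alpha$; $\underline 1$ abbreviates $2j_*(\underline 0)$. Structures are built from formulas by a binary symbol "$,$", unary symbols $\circ_2,\bullet_2,\circ_\alpha$ and a constant $\epsilon$. A context $\Gamma[\ ]$ is a structure with one hole. A sequent is $\gamma\vdash b$, with $\gamma$ a structure and $b$ a formula. For a dyadic $d=k/2^n\in(0,1)$ with $k$ odd, $\epsilon_d$ is the structure consisting of $k$ copies of $\circ_\alpha^{n-1}\bullet_2\epsilon$ joined by "$,$"; $\epsilon_0=\epsilon$; $\epsilon_1=\circ_2\bullet_2\epsilon$. **Rules of $\mathbf{LJK}$** (premises / conclusion; "$\Leftrightarrow$" means both directions; $a,b,c,A$ formulas, $\gamma,\delta,\pi$ structures). Logical rules: $/\ a\vdash a$; $\Gamma[a,b]\vdash c\ /\ \Gamma[a\dot+b]\vdash c$; $\gamma\vdash a,\ \delta\vdash b\ /\ \gamma,\delta\vdash a\dot+b$; $\Gamma[b]\vdash c,\ \gamma\vdash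 a\ /\ \Gamma[(b\dot-a),\gamma]\vdash c$, and the same with conclusion $\Gamma[\gamma,(b\dot-a)]\vdash c$; $\gamma,a\vdash b\ /\ \gamma\vdash b\dot-a$, and the same with premise $a,\gamma\vdash b$; $\Gamma[\epsilon]\vdash a\ /\ \Gamma[\underline 0]\vdash a$; $/\ \epsilon\vdash\underline 0$; $\Gamma[a]\vdash c,\ \Gamma[b]\vdash c\ /\ \Gamma[a\wedge b]\vdash c$; $\gamma\vdash a\ /\ \gamma\vdash a\wedge b$; $\gamma\vdash b\ /\ \gamma\vdash a\wedge b$; $\Gamma[a]\vdash c\ /\ \Gamma[a\vee b]\vdash c$; $\Gamma[b]\vdash c\ /\ \Gamma[a\vee b]\vdash c$; $\gamma\vdash a,\ \gamma\vdash b\ /\ \gamma\vdash a\vee b$. Modal rules, for $(\circ,P,N)$ each of $(\circ_2,2,\frac{\cdot}{2})$, $(\bullet_2,j_*,j)$, $(\circ_\alpha,\alpha,\blacksquare_\alpha)$: $\Gamma[\circ a]\vdash b\ /\ \Gamma[Pa]\vdash b$; $\gamma\vdash a\ /\ \circ\gamma\vdash Pa$; $\Gamma[a]\vdash b\ /\ \Gamma[\circ Na]\vdash b$; $\circ\gamma\vdash a\ /\ \gamma\vdash Na$. Structural rules: - $\Gamma[\gamma,\delta]\vdash A\ /\ \Gamma[\delta,\gamma]\vdash A$; $\Gamma[\gamma,(\delta,\pi)]\vdash A\ /\ \Gamma[(\gamma,\delta),\pi]\vdash A$; $\Gamma[\epsilon,\gamma]\vdash A\Leftrightarrow\Gamma[\gamma]\vdash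 A$; - $\Gamma[\gamma]\vdash A\ /\ \Gamma[\circ_2\gamma]\vdash A$; $\Gamma[\gamma]\vdash A\ /\ \Gamma[\bullet_2\gamma]\vdash A$; $\Gamma[\epsilon]\vdash A\ /\ \Gamma[\gamma]\vdash A$; - $\Gamma[\circ_2\gamma]\vdash A,\ \Gamma[\circ_2\delta]\vdash A\ /\ \Gamma[\gamma,\delta]\vdash A$; $\Gamma[\gamma,\gamma]\vdash A\ /\ \Gamma[\circ_2\gamma]\vdash A$; $/\ \epsilon_1\vdash A$; - $\Gamma[\bullet_2(\circ_2\gamma,\delta)]\vdash A\Leftrightarrow\Gamma[\gamma,\bullet_2\delta]\vdash A$; - $\Gamma[\gamma]\vdash A\ /\ \Gamma[\circ_\alpha\circ_2\gamma]\vdash A$; $\Gamma[\gamma]\vdash A\ /\ \Gamma[\circ_\alpha\bullet_2\gamma]\vdash A$; $\Gamma[\circ_\alpha\circ_2\gamma]\vdash A,\ \Gamma[\circ_\alpha\bullet_2\gamma]\vdash A\ /\ \Gamma[\gamma]\vdash A$; - $\Gamma[\gamma]\vdash A\ /\ \Gamma[\circ_2\circ_\alpha\gamma]\vdash A$; $\Gamma[\gamma]\vdash A\ /\ \Gamma[\bullet_2\circ_\alpha\gamma]\vdash A$; $\Gamma[\circ_2\circ_\alpha\gamma]\vdash A,\ \Gamma[\bullet_2\circ_\alpha\gamma]\vdash A\ /\ \Gamma[\gamma]\vdash A$; - for dyadic $d\in[0,1]$ and $n\in\mathbb N$: $\Gamma[\gamma]\vdash A\ /\ \Gamma[\epsilon_d,\circ_\alpha^n(\gamma,\epsilon_{1-d})]\vdash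 A$; - for $n\ge1$: $\Gamma[\epsilon_{1/2^n},\epsilon_{1/2^n}]\vdash A\ /\ \Gamma[\epsilon_{1/2^{n-1}}]\vdash A$; - (infinitary) $\Gamma[\epsilon_{1/2^n}]\vdash A$ for all $n\in\mathbb N\ /\ \Gamma[\epsilon]\vdash A$; - for $n\in\mathbb N$: $\Gamma[\epsilon_{1-k/2^{n+1}},\circ_\alpha^{n+1}(\gamma,\epsilon_{k/2^{n+1}})]\vdash A$ for $k=1,\dots,2^{n+1}-2\ /\ \Gamma[\gamma,\epsilon_{1/2^n}]\vdash A$. **Cut rule** (not part of $\mathbf{LJK}$): $\gamma\vdash a,\ \Gamma[a]\vdash b\ /\ \Gamma[\gamma]\vdash b$. -}

module Defs where

open import Data.Nat.Base as ℕ using (ℕ; zero; suc; _^_)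
open import Data.Nat.Logarithm using (⌊log₂_⌋)
open import Data.Nat.Properties using (m^n≢0)
open import Data.Integer.Base using (+_; ∣_∣)
open import Data.Product.Base using (∃-syntax)
open import Data.Rational.Base as ℚ using (ℚ; 0ℚ; 1ℚ; ↥_; ↧ₙ_)
open import Relation.Binary.PropositionalEquality.Core using (_≡_)

infixl 6 _∔_ _∸_
infixr 6 _∧_ _∨_
infixr 7 _$P_ _$N_ _$S_ ↑_
infixl 5 _,,_ _◁,_ _,▷_
infix  3 _▷_⊢_

-- Each modality m comes with a triple (structural symbol, P, N), written
-- m $S γ, m $P a and m $N a; the pattern synonyms below give their
-- individual names (∘₂, 2, ·/2), (•₂, j⋆, j), (∘α, α, ■α).
data Modality : Set where
  two jay alpha : Modality

data Formula (V : Set) : Set where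
  var     : V → Formula V
  𝟎       : Formula V
  _∔_ _∸_ : Formula V → Formula V → Formula V
  _∧_ _∨_ : Formula V → Formula V → Formula V
  _$P_    : Modality → Formula V → Formula V
  _$N_    : Modality → Formula V → Formula V

pattern 𝟐  a = two   $P a
pattern ½  a = two   $N a
pattern j⋆ a = jay   $P a
pattern j  a = jay   $N a
pattern α  a = alpha $P a
pattern ■α a = alpha $N a

𝟏 : ∀ {V} → Formula V
𝟏 = 𝟐 (j⋆ 𝟎)

-- Terms over the leaves X in the structural symbols; "," is written _,,_.
data Term (X : Set) : Set where
  ↑_   : X → Term X
  _,,_ : Term X → Term X → Term X
  _$S_ : Modality → Term X → Term X
  ε    : Term X

pattern ∘₂ γ = two   $S γ
pattern •₂ γ = jay   $S γ
pattern ∘α γ = alpha $S γ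

Structure : Set → Set
Structure V = Term (Formula V)

_⟪_⟫ : ∀ {X Y} → Term X → (X → Y) → Term Y
(↑ x)    ⟪ f ⟫ = ↑ f x
(s ,, t) ⟪ f ⟫ = s ⟪ f ⟫ ,, t ⟪ f ⟫
(m $S t) ⟪ f ⟫ = m $S (t ⟪ f ⟫)
ε        ⟪ f ⟫ = ε

data Context (V : Set) : Set where
  □    : Context V
  _◁,_ : Context V → Structure V → Context V
  _,▷_ : Structure V → Context V → Context V
  _$S_ : Modality → Context V → Context V

_[_] : ∀ {V} → Context V → Structure V → Structure V
□        [ γ ] = γ
(Γ ◁, δ) [ γ ] = Γ [ γ ] ,, δ
(δ ,▷ Γ) [ γ ] = δ ,, Γ [ γ ]
(m $S Γ) [ γ ] = m $S (Γ [ γ ])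

∘α^ : ∀ {X} → ℕ → Term X → Term X
∘α^ zero    γ = γ
∘α^ (suc n) γ = ∘α (∘α^ n γ)

-- k + 1 copies of γ joined by ",".
copies⁺ : ∀ {X} → ℕ → Term X → Term X
copies⁺ zero    γ = γ
copies⁺ (suc k) γ = γ ,, copies⁺ k γ

-- ε for the dyadic k/2ⁿ in [0,1], given in lowest terms (so that the second
-- clause is only relevant for 1/2⁰ and in the third the numerator is odd).
ε-dyadic : ∀ {X} → (k n : ℕ) → Term X
ε-dyadic zero    _       = ε
ε-dyadic (suc _) zero    = ∘₂ (•₂ ε)
ε-dyadic (suc k) (suc n) = copies⁺ k (∘α^ n (•₂ ε))

-- ℚ is kept in lowest terms, so for a dyadic d the denominator is exactly 2ⁿ.
-- The value is meaningless unless d is dyadic and lies in [0,1].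
ε⟨_⟩ : ∀ {X} → ℚ → Term X
ε⟨ d ⟩ = ε-dyadic ∣ ↥ d ∣ ⌊log₂ ↧ₙ d ⌋

Dyadic : ℚ → Set
Dyadic d = ∃[ n ] ↧ₙ d ≡ 2 ^ n

_/2^_ : ℕ → ℕ → ℚ
k /2^ n = (+ k ℚ./ 2 ^ n) {{m^n≢0 2 n}}

data System : Set where
  LJK LJK+cut : System

private variable
  V       : Set
  S       : System
  Γ       : Context V
  γ δ π   : Structure V
  a b c A : Formula V
  m       : Modality

data _▷_⊢_ {V : Set} : System → Structure V → Formula V → Set where

  id    : S ▷ ↑ a ⊢ a

  ∔-L   : S ▷ Γ [ ↑ a ,, ↑ b ] ⊢ c →
          S ▷ Γ [ ↑ (a ∔ b) ] ⊢ c
  ∔-R   : S ▷ γ ⊢ a → S ▷ δ ⊢ b →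
          S ▷ γ ,, δ ⊢ a ∔ b

  ∸-L₁  : S ▷ Γ [ ↑ b ] ⊢ c → S ▷ γ ⊢ a →
          S ▷ Γ [ ↑ (b ∸ a) ,, γ ] ⊢ c
  ∸-L₂  : S ▷ Γ [ ↑ b ] ⊢ c → S ▷ γ ⊢ a →
          S ▷ Γ [ γ ,, ↑ (b ∸ a) ] ⊢ c
  ∸-R₁  : S ▷ γ ,, ↑ a ⊢ b →
          S ▷ γ ⊢ b ∸ a
  ∸-R₂  : S ▷ ↑ a ,, γ ⊢ b →
          S ▷ γ ⊢ b ∸ a

  𝟎-L   : S ▷ Γ [ ε ] ⊢ a →
          S ▷ Γ [ ↑ 𝟎 ] ⊢ a
  𝟎-R   : S ▷ ε ⊢ 𝟎

  ∧-L   : S ▷ Γ [ ↑ a ] ⊢ c → S ▷ Γ [ ↑ b ] ⊢ c →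
          S ▷ Γ [ ↑ (a ∧ b) ] ⊢ c
  ∧-R₁  : S ▷ γ ⊢ a →
          S ▷ γ ⊢ a ∧ b
  ∧-R₂  : S ▷ γ ⊢ b →
          S ▷ γ ⊢ a ∧ b

  ∨-L₁  : S ▷ Γ [ ↑ a ] ⊢ c →
          S ▷ Γ [ ↑ (a ∨ b) ] ⊢ c
  ∨-L₂  : S ▷ Γ [ ↑ b ] ⊢ c →
          S ▷ Γ [ ↑ (a ∨ b) ] ⊢ c
  ∨-R   : S ▷ γ ⊢ a → S ▷ γ ⊢ b →
          S ▷ γ ⊢ a ∨ b

  P-L   : S ▷ Γ [ m $S ↑ a ] ⊢ b →
          S ▷ Γ [ ↑ (m $P a) ] ⊢ b
  P-R   : S ▷ γ ⊢ a →
          S ▷ m $S γ ⊢ m $P a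
  N-L   : S ▷ Γ [ ↑ a ] ⊢ b →
          S ▷ Γ [ m $S ↑ (m $N a) ] ⊢ b
  N-R   : S ▷ m $S γ ⊢ a →
          S ▷ γ ⊢ m $N a

  exchange   : S ▷ Γ [ γ ,, δ ] ⊢ A →
               S ▷ Γ [ δ ,, γ ] ⊢ A
  assoc      : S ▷ Γ [ γ ,, (δ ,, π) ] ⊢ A →
               S ▷ Γ [ (γ ,, δ) ,, π ] ⊢ A
  unit-elim  : S ▷ Γ [ ε ,, γ ] ⊢ A →
               S ▷ Γ [ γ ] ⊢ A
  unit-intro : S ▷ Γ [ γ ] ⊢ A →
               S ▷ Γ [ ε ,, γ ] ⊢ A

  ∘₂-intro   : S ▷ Γ [ γ ] ⊢ A →
               S ▷ Γ [ ∘₂ γ ] ⊢ A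
  •₂-intro   : S ▷ Γ [ γ ] ⊢ A →
               S ▷ Γ [ •₂ γ ] ⊢ A
  weaken     : S ▷ Γ [ ε ] ⊢ A →
               S ▷ Γ [ γ ] ⊢ A

  ∘₂-split   : S ▷ Γ [ ∘₂ γ ] ⊢ A → S ▷ Γ [ ∘₂ δ ] ⊢ A →
               S ▷ Γ [ γ ,, δ ] ⊢ A
  ∘₂-merge   : S ▷ Γ [ γ ,, γ ] ⊢ A →
               S ▷ Γ [ ∘₂ γ ] ⊢ A
  ε₁-ax      : S ▷ ε⟨ 1ℚ ⟩ ⊢ A

  •₂-pull    : S ▷ Γ [ •₂ (∘₂ γ ,, δ) ] ⊢ A →
               S ▷ Γ [ γ ,, •₂ δ ] ⊢ A
  •₂-push    : S ▷ Γ [ γ ,, •₂ δ ] ⊢ A →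
               S ▷ Γ [ •₂ (∘₂ γ ,, δ) ] ⊢ A

  ∘α∘₂-intro : S ▷ Γ [ γ ] ⊢ A →
               S ▷ Γ [ ∘α (∘₂ γ) ] ⊢ A
  ∘α•₂-intro : S ▷ Γ [ γ ] ⊢ A →
               S ▷ Γ [ ∘α (•₂ γ) ] ⊢ A
  ∘α-elim    : S ▷ Γ [ ∘α (∘₂ γ) ] ⊢ A → S ▷ Γ [ ∘α (•₂ γ) ] ⊢ A →
               S ▷ Γ [ γ ] ⊢ A

  ∘₂∘α-intro : S ▷ Γ [ γ ] ⊢ A →
               S ▷ Γ [ ∘₂ (∘α γ) ] ⊢ A
  •₂∘α-intro : S ▷ Γ [ γ ] ⊢ A →
               S ▷ Γ [ •₂ (∘α γ) ] ⊢ A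
  ∘α-elim′   : S ▷ Γ [ ∘₂ (∘α γ) ] ⊢ A → S ▷ Γ [ •₂ (∘α γ) ] ⊢ A →
               S ▷ Γ [ γ ] ⊢ A

  dyadic     : ∀ (d : ℚ) → Dyadic d → 0ℚ ℚ.≤ d → d ℚ.≤ 1ℚ → (n : ℕ) →
               S ▷ Γ [ γ ] ⊢ A →
               S ▷ Γ [ ε⟨ d ⟩ ,, ∘α^ n (γ ,, ε⟨ 1ℚ ℚ.- d ⟩) ] ⊢ A

  halves     : ∀ (n : ℕ) → 1 ℕ.≤ n →
               S ▷ Γ [ ε⟨ 1 /2^ n ⟩ ,, ε⟨ 1 /2^ n ⟩ ] ⊢ A →
               S ▷ Γ [ ε⟨ 1 /2^ (n ℕ.∸ 1) ⟩ ] ⊢ A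

  limit      : (∀ (n : ℕ) → S ▷ Γ [ ε⟨ 1 /2^ n ⟩ ] ⊢ A) →
               S ▷ Γ [ ε ] ⊢ A

  -- For n = 0 there are no premises.
  cover      : ∀ (n : ℕ) →
               (∀ (k : ℕ) → 1 ℕ.≤ k → k ℕ.≤ 2 ^ suc n ℕ.∸ 2 →
                 S ▷ Γ [ ε⟨ 1ℚ ℚ.- k /2^ suc n ⟩
                         ,, ∘α^ (suc n) (γ ,, ε⟨ k /2^ suc n ⟩) ] ⊢ A) →
               S ▷ Γ [ γ ,, ε⟨ 1 /2^ n ⟩ ] ⊢ A

  cut   : LJK+cut ▷ γ ⊢ a → LJK+cut ▷ Γ [ ↑ a ] ⊢ b →
          LJK+cut ▷ Γ [ γ ] ⊢ b

{-# OPTIONS --safe #-}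

-- Semantic cut elimination. Each formula a is interpreted by a set ⟦ a ⟧ of
-- structures, closed for the Galois connection induced by cut-free
-- derivability Γ [ γ ] ⊢ b between structures γ and pairs (Γ , b), so that a
-- itself lies in ⟦ a ⟧ and every member of ⟦ a ⟧ derives a without cut. The
-- rules, cut included, are sound for the reading "replacing each leaf a of γ by
-- a member of ⟦ a ⟧ gives a member of ⟦ b ⟧"; replacing each leaf by itself then
-- gives a cut-free derivation. Structural rules are sound because every
-- metavariable occurs at most once in a conclusion. ε₁-ax, the only one stated
-- without a context, is sound because it is admissible in every context.
module Submission where

open import Defs
open import Data.Nat.Base as ℕ using (ℕ; zero; suc; _^_)
open import Data.Nat.Logarithm using (⌊log₂_⌋)
open import Data.Fin.Base using (Fin)
open import Data.Integer.Base using (∣_∣)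
open import Data.Product.Base using (_,_; proj₁; proj₂)
open import Data.Rational.Base as ℚ using (ℚ; 1ℚ; ↥_; ↧ₙ_)
open import Data.Sum.Base using (inj₁; inj₂)
open import Relation.Binary.PropositionalEquality.Core using (_≡_; refl; cong; cong₂; subst; sym)
open import Relation.Unary using (Pred; _⊆_; _∪_; _∩_; _∈_)
open import Level using (0ℓ)

private variable
  V         : Set
  a b c A   : Formula V
  s t u     : Structure V
  m         : Modality

infixr 9 _⊙_
infix 3 _⊨_

_⊙_ : Context V → Context V → Context V
□        ⊙ Γ = Γ
(Δ ◁, δ) ⊙ Γ = (Δ ⊙ Γ) ◁, δ
(δ ,▷ Δ) ⊙ Γ = δ ,▷ (Δ ⊙ Γ)
(m $S Δ) ⊙ Γ = m $S (Δ ⊙ Γ)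

⊙-[] : (Δ Γ : Context V) (t : Structure V) → (Δ ⊙ Γ) [ t ] ≡ Δ [ Γ [ t ] ]
⊙-[] □        Γ t = refl
⊙-[] (Δ ◁, δ) Γ t = cong (_,, δ) (⊙-[] Δ Γ t)
⊙-[] (δ ,▷ Δ) Γ t = cong (δ ,,_) (⊙-[] Δ Γ t)
⊙-[] (m $S Δ) Γ t = cong (m $S_) (⊙-[] Δ Γ t)

-- For a variable `Δ` the two sides of `⊙-[]` are not equal by computation, so derivations are
-- transported explicitly.
nest : (Δ Γ : Context V) → LJK ▷ (Δ ⊙ Γ) [ t ] ⊢ A → LJK ▷ Δ [ Γ [ t ] ] ⊢ A
nest {t = t} {A} Δ Γ = subst (LJK ▷_⊢ A) (⊙-[] Δ Γ t)

unnest : (Δ Γ : Context V) → LJK ▷ Δ [ Γ [ t ] ] ⊢ A → LJK ▷ (Δ ⊙ Γ) [ t ] ⊢ A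
unnest {t = t} {A} Δ Γ = subst (LJK ▷_⊢ A) (sym (⊙-[] Δ Γ t))

ε₁ : Structure V
ε₁ = ∘₂ (•₂ ε)

-- ∘₂ (•₂ ε) reduces to •₂ ε ,, •₂ ε and then to •₂ (ε₁ ,, ε), whose •₂ cancels
-- against the ∘α.
∘α-ε₁ : (Δ : Context V) → LJK ▷ Δ [ ε₁ ] ⊢ A → LJK ▷ Δ [ ∘α ε₁ ] ⊢ A
∘α-ε₁ Δ d =
  nest Δ ∘α□ (∘₂-merge {Γ = Δ ⊙ ∘α□} (•₂-pull {Γ = Δ ⊙ ∘α□} (unnest Δ ∘α□
    (∘α•₂-intro {Γ = Δ} (exchange {Γ = Δ} (unit-intro {Γ = Δ} d))))))
  where ∘α□ = alpha $S □

$S-ε₁ : (m : Modality) (Δ : Context V) → LJK ▷ Δ [ ε₁ ] ⊢ A → LJK ▷ Δ [ m $S ε₁ ] ⊢ A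
$S-ε₁ two   Δ = ∘₂-intro {Γ = Δ}
$S-ε₁ jay   Δ = •₂-intro {Γ = Δ}
$S-ε₁ alpha Δ = ∘α-ε₁ Δ

ε₁-,, : (Δ : Context V) (δ : Structure V) → LJK ▷ Δ [ ε₁ ] ⊢ A → LJK ▷ Δ [ δ ,, ε₁ ] ⊢ A
ε₁-,, Δ δ d = nest Δ □,ε₁ (weaken {Γ = Δ ⊙ □,ε₁} (unnest Δ □,ε₁ (unit-intro {Γ = Δ} d)))
  where □,ε₁ = □ ◁, ε₁

-- The frames of `Γ` move onto `Δ` from the outside in, so each step only has to put a single frame
-- around `ε₁`.
absorb : (Δ Γ : Context V) → LJK ▷ Δ [ ε₁ ] ⊢ A → LJK ▷ Δ [ Γ [ ε₁ ] ] ⊢ A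
absorb Δ □        d = d
absorb Δ (Γ ◁, δ) d =
  nest Δ (□ ◁, δ) (absorb (Δ ⊙ (□ ◁, δ)) Γ (unnest Δ (□ ◁, δ) (exchange {Γ = Δ} (ε₁-,, Δ δ d))))
absorb Δ (δ ,▷ Γ) d =
  nest Δ (δ ,▷ □) (absorb (Δ ⊙ (δ ,▷ □)) Γ (unnest Δ (δ ,▷ □) (ε₁-,, Δ δ d)))
absorb Δ (m $S Γ) d =
  nest Δ (m $S □) (absorb (Δ ⊙ (m $S □)) Γ (unnest Δ (m $S □) ($S-ε₁ m Δ d)))

ε₁-⊢ : (Γ : Context V) → LJK ▷ Γ [ ε₁ ] ⊢ A
ε₁-⊢ Γ = absorb □ Γ ε₁-ax

StructureSet : Set → Set₁
StructureSet V = Pred (Structure V) 0ℓ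

-- The double polar in continuation form. A membership `s ∈ cl X` acts as an elimination rule: to
-- derive `Γ [ s ] ⊢ c`, one may take `s` to be a member of `X`.
cl : StructureSet V → StructureSet V
cl X s = ∀ Γ {c} → (∀ {t} → t ∈ X → LJK ▷ Γ [ t ] ⊢ c) → LJK ▷ Γ [ s ] ⊢ c

cl-idem : (X : StructureSet V) → cl (cl X) ⊆ cl X
cl-idem X p Γ k = p Γ (λ q → q Γ k)

data _⊗_ (X Y : StructureSet V) : StructureSet V where
  _,,_ : s ∈ X → t ∈ Y → (s ,, t) ∈ (X ⊗ Y)

data Image (m : Modality) (X : StructureSet V) : StructureSet V where
  image : s ∈ X → (m $S s) ∈ Image m X

-- By the rules, `∧` is the join and `∨` the meet of the derivability order, hence union and
-- intersection. Sets built from generators need `cl`; those given by a condition inherit closedness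
-- from their components.
⟦_⟧ : Formula V → StructureSet V
⟦ var p ⟧  s = LJK ▷ s ⊢ var p
⟦ 𝟎 ⟧        = cl (_≡ ε)
⟦ a ∔ b ⟧    = cl (⟦ a ⟧ ⊗ ⟦ b ⟧)
⟦ b ∸ a ⟧  s = ∀ {t} → t ∈ ⟦ a ⟧ → (s ,, t) ∈ ⟦ b ⟧
⟦ a ∧ b ⟧    = cl (⟦ a ⟧ ∪ ⟦ b ⟧)
⟦ a ∨ b ⟧    = ⟦ a ⟧ ∩ ⟦ b ⟧
⟦ m $P a ⟧   = cl (Image m ⟦ a ⟧)
⟦ m $N a ⟧ s = (m $S s) ∈ ⟦ a ⟧

closed : (a : Formula V) → cl ⟦ a ⟧ ⊆ ⟦ a ⟧
closed (var p)  h = h □ (λ d → d)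
closed 𝟎        h = cl-idem (_≡ ε) h
closed (a ∔ b)  h = cl-idem (⟦ a ⟧ ⊗ ⟦ b ⟧) h
-- The argument `t` becomes a frame of the test context, which leaves only closedness of `⟦ b ⟧` to
-- be used.
closed (b ∸ a) {s} h {t} y = closed b λ Γ k →
  nest Γ (□ ◁, t) (h (Γ ⊙ (□ ◁, t)) λ f → unnest Γ (□ ◁, t) (k (f y)))
closed (a ∧ b)  h = cl-idem (⟦ a ⟧ ∪ ⟦ b ⟧) h
closed (a ∨ b)  h = closed a (λ Γ k → h Γ (λ x → k (proj₁ x)))
                  , closed b (λ Γ k → h Γ (λ x → k (proj₂ x)))
closed (m $P a) h = cl-idem (Image m ⟦ a ⟧) h
closed (m $N a) h = closed a λ Γ k →
  nest Γ (m $S □) (h (Γ ⊙ (m $S □)) λ x → unnest Γ (m $S □) (k x))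

-- Left rules give `reflect`, right rules `reify`. They are mutual because `b ∸ a` is contravariant
-- in `a`.
reflect : (a : Formula V) → (↑ a) ∈ ⟦ a ⟧
reify   : (a : Formula V) → s ∈ ⟦ a ⟧ → LJK ▷ s ⊢ a

reflect (var p)  = id
reflect 𝟎        = λ Γ k → 𝟎-L {Γ = Γ} (k refl)
reflect (a ∔ b)  = λ Γ k → ∔-L {Γ = Γ} (k (reflect a ,, reflect b))
reflect (b ∸ a)  = λ y → closed b λ Γ k → ∸-L₁ {Γ = Γ} (k (reflect b)) (reify a y)
reflect (a ∧ b)  = λ Γ k → ∧-L {Γ = Γ} (k (inj₁ (reflect a))) (k (inj₂ (reflect b)))
reflect (a ∨ b)  = closed a (λ Γ k → ∨-L₁ {Γ = Γ} (k (reflect a)))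
                 , closed b (λ Γ k → ∨-L₂ {Γ = Γ} (k (reflect b)))
reflect (m $P a) = λ Γ k → P-L {Γ = Γ} (k (image (reflect a)))
reflect (m $N a) = closed a λ Γ k → N-L {Γ = Γ} (k (reflect a))

reify (var p)  d = d
reify 𝟎        h = h □ λ { refl → 𝟎-R }
reify (a ∔ b)  h = h □ λ { (x ,, y) → ∔-R (reify a x) (reify b y) }
reify (b ∸ a)  f = ∸-R₁ (reify b (f (reflect a)))
reify (a ∧ b)  h = h □ λ { (inj₁ x) → ∧-R₁ (reify a x) ; (inj₂ y) → ∧-R₂ (reify b y) }
reify (a ∨ b)  x = ∨-R (reify a (proj₁ x)) (reify b (proj₂ x))
reify (m $P a) h = h □ λ { (image x) → P-R (reify a x) }
reify (m $N a) x = N-R (reify a x)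

-- A relation rather than a substitution: two leaves carrying the same formula may receive different
-- members.
data Instance {V : Set} : Structure V → Structure V → Set where
  ↑_   : s ∈ ⟦ a ⟧ → Instance (↑ a) s
  _,,_ : ∀ {s s′} → Instance s s′ → Instance t u → Instance (s ,, t) (s′ ,, u)
  _$S_ : ∀ m → Instance s t → Instance (m $S s) (m $S t)
  ε    : Instance ε ε

self : (s : Structure V) → Instance s s
self (↑ a)    = ↑ reflect a
self (s ,, t) = self s ,, self t
self (m $S s) = m $S self s
self ε        = ε

-- Rules naming `ε⟨ d ⟩` apply only to that very structure, so its instances must be itself; for
-- variable `d` this takes a proof.
Rigid : Structure V → Set
Rigid t = ∀ {s} → Instance t s → s ≡ t

∘α^-rigid : ∀ n → Rigid t → Rigid (∘α^ n t)
∘α^-rigid zero    r i            = r i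
∘α^-rigid (suc n) r (.alpha $S i) = cong (alpha $S_) (∘α^-rigid n r i)

copies⁺-rigid : ∀ k → Rigid t → Rigid (copies⁺ k t)
copies⁺-rigid zero    r i        = r i
copies⁺-rigid (suc k) r (i ,, i′) = cong₂ _,,_ (r i) (copies⁺-rigid k r i′)

•₂ε-rigid : Rigid {V} (•₂ ε)
•₂ε-rigid (.jay $S ε) = refl

ε-dyadic-rigid : ∀ k n → Rigid {V} (ε-dyadic k n)
ε-dyadic-rigid zero    n       ε                     = refl
ε-dyadic-rigid (suc k) zero    (.two $S (.jay $S ε)) = refl
ε-dyadic-rigid (suc k) (suc n) i = copies⁺-rigid k (∘α^-rigid n •₂ε-rigid) i

ε⟨⟩-rigid : ∀ d → Rigid {V} ε⟨ d ⟩
ε⟨⟩-rigid d = ε-dyadic-rigid ∣ ↥ d ∣ ⌊log₂ ↧ₙ d ⌋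

-- For variable `n`, `∘α^ n t` does not reduce and an `Instance` of it cannot be inverted by
-- matching; this family records the inverted form.
data ∘α^-Instance (n : ℕ) (t : Structure V) : StructureSet V where
  ∘α^-inst : Instance t s → ∘α^-Instance n t (∘α^ n s)

∘α^-invert : ∀ n → Instance (∘α^ n t) s → ∘α^-Instance n t s
∘α^-invert zero    i             = ∘α^-inst i
∘α^-invert (suc n) (.alpha $S i) with ∘α^-invert n i
... | ∘α^-inst i′ = ∘α^-inst i′

∘α^-instance : ∀ n → Instance t s → Instance (∘α^ n t) (∘α^ n s)
∘α^-instance zero    i = i
∘α^-instance (suc n) i = alpha $S ∘α^-instance n i

-- The last field ranges over every `u`, since the premises and the conclusion of a rule fill the
-- hole differently while sharing the instance `Γ′` of the context.
data Split {V : Set} (Γ : Context V) (t : Structure V) : StructureSet V where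
  split : ∀ Γ′ {t′} → Instance t t′ →
          (∀ {u u′} → Instance u u′ → Instance (Γ [ u ]) (Γ′ [ u′ ])) →
          Split Γ t (Γ′ [ t′ ])

split-instance : (Γ : Context V) → Instance (Γ [ t ]) s → Split Γ t s
split-instance □        i = split □ i (λ i′ → i′)
split-instance (Γ ◁, δ) (i ,, i₂) with split-instance Γ i
... | split Γ′ i′ plug = split (Γ′ ◁, _) i′ (λ k → plug k ,, i₂)
split-instance (δ ,▷ Γ) (i₂ ,, i) with split-instance Γ i
... | split Γ′ i′ plug = split (_ ,▷ Γ′) i′ (λ k → i₂ ,, plug k)
split-instance (m $S Γ) (.m $S i) with split-instance Γ i
... | split Γ′ i′ plug = split (m $S Γ′) i′ (λ k → m $S plug k)

record _⊨_ {V : Set} (s : Structure V) (b : Formula V) : Set where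
  field holds : Instance s t → t ∈ ⟦ b ⟧

open _⊨_

-- A left rule only has to be checked on instances of its active part: the
-- instance of the context is absorbed into Δ.
⊨-left : (Γ : Context V) →
         (∀ {t′} → Instance t t′ → ∀ Δ {c} →
           (∀ {u u′} → Γ [ u ] ⊨ b → Instance u u′ → LJK ▷ Δ [ u′ ] ⊢ c) →
           LJK ▷ Δ [ t′ ] ⊢ c) →
         Γ [ t ] ⊨ b
⊨-left {b = b} Γ h .holds i with split-instance Γ i
... | split Γ′ i′ plug = closed b λ Δ k →
  nest Δ Γ′ (h i′ (Δ ⊙ Γ′) λ v i₂ → unnest Δ Γ′ (k (holds v (plug i₂))))

-- Serves the rules, cut among them, where an instance of the conclusion's active part already is
-- one of the premise's.
⊨-replace : (Γ : Context V) → (∀ {t′} → Instance t t′ → Instance u t′) →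
            Γ [ u ] ⊨ b → Γ [ t ] ⊨ b
⊨-replace Γ f v = ⊨-left Γ λ i Δ k → k v (f i)

sound : ∀ {S} → S ▷ s ⊢ a → s ⊨ a
sound id .holds (↑ x) = x
sound (∔-L {Γ = Γ} d) = ⊨-left Γ λ { (↑ h) Δ k → h Δ λ { (x ,, y) → k (sound d) ((↑ x) ,, (↑ y)) } }
sound (∔-R d e) .holds (i ,, i₂) Γ k = k (holds (sound d) i ,, holds (sound e) i₂)
sound (∸-L₁ {Γ = Γ} d e) = ⊨-replace Γ (λ { ((↑ f) ,, i) → ↑ f (holds (sound e) i) }) (sound d)
-- `⟦ b ∸ a ⟧` takes its argument on the right, so the mirrored rule costs an `exchange`.
sound (∸-L₂ {Γ = Γ} d e) = ⊨-left Γ λ { (i ,, (↑ f)) Δ k →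
  exchange {Γ = Δ} (k (sound d) (↑ f (holds (sound e) i))) }
sound (∸-R₁ d) .holds i y = holds (sound d) (i ,, (↑ y))
sound (∸-R₂ {b = b} d) .holds i y = closed b λ Γ k → exchange {Γ = Γ} (k (holds (sound d) ((↑ y) ,, i)))
sound (𝟎-L {Γ = Γ} d) = ⊨-left Γ λ { (↑ h) Δ k → h Δ λ { refl → k (sound d) ε } }
sound 𝟎-R .holds ε Γ k = k refl
sound (∧-L {Γ = Γ} d e) = ⊨-left Γ λ { (↑ h) Δ k → h Δ λ
  { (inj₁ x) → k (sound d) (↑ x) ; (inj₂ y) → k (sound e) (↑ y) } }
sound (∧-R₁ d) .holds i Γ k = k (inj₁ (holds (sound d) i))
sound (∧-R₂ d) .holds i Γ k = k (inj₂ (holds (sound d) i))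
sound (∨-L₁ {Γ = Γ} d) = ⊨-replace Γ (λ { (↑ x) → ↑ proj₁ x }) (sound d)
sound (∨-L₂ {Γ = Γ} d) = ⊨-replace Γ (λ { (↑ x) → ↑ proj₂ x }) (sound d)
sound (∨-R d e) .holds i = holds (sound d) i , holds (sound e) i
sound (P-L {Γ = Γ} {m = m} d) = ⊨-left Γ λ { (↑ h) Δ k → h Δ λ { (image x) → k (sound d) (m $S (↑ x)) } }
sound (P-R d) .holds (m $S i) Γ k = k (image (holds (sound d) i))
sound (N-L {Γ = Γ} d) = ⊨-replace Γ (λ { (m $S (↑ x)) → ↑ x }) (sound d)
sound (N-R {m = m} d) .holds i = holds (sound d) (m $S i)
sound (exchange {Γ = Γ} d) = ⊨-left Γ λ { (i ,, i₂) Δ k → exchange {Γ = Δ} (k (sound d) (i₂ ,, i)) }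
sound (assoc {Γ = Γ} d) = ⊨-left Γ λ { ((i ,, i₂) ,, l) Δ k → assoc {Γ = Δ} (k (sound d) (i ,, (i₂ ,, l))) }
sound (unit-elim {Γ = Γ} d) = ⊨-left Γ λ i Δ k → unit-elim {Γ = Δ} (k (sound d) (ε ,, i))
sound (unit-intro {Γ = Γ} d) = ⊨-left Γ λ { (ε ,, i) Δ k → unit-intro {Γ = Δ} (k (sound d) i) }
sound (∘₂-intro {Γ = Γ} d) = ⊨-left Γ λ { (.two $S i) Δ k → ∘₂-intro {Γ = Δ} (k (sound d) i) }
sound (•₂-intro {Γ = Γ} d) = ⊨-left Γ λ { (.jay $S i) Δ k → •₂-intro {Γ = Δ} (k (sound d) i) }
sound (weaken {Γ = Γ} d) = ⊨-left Γ λ i Δ k → weaken {Γ = Δ} (k (sound d) ε)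
sound (∘₂-split {Γ = Γ} d e) = ⊨-left Γ λ { (i ,, i₂) Δ k →
  ∘₂-split {Γ = Δ} (k (sound d) (two $S i)) (k (sound e) (two $S i₂)) }
-- The single instance of `γ` serves both copies in the premise.
sound (∘₂-merge {Γ = Γ} d) = ⊨-left Γ λ { (.two $S i) Δ k → ∘₂-merge {Γ = Δ} (k (sound d) (i ,, i)) }
-- `ε⟨ 1ℚ ⟩` computes to `ε₁`, which lies in the closure of the empty set and hence in every closed
-- set.
sound {a = a} ε₁-ax .holds i with refl ← ε⟨⟩-rigid 1ℚ i = closed a λ Γ k → ε₁-⊢ Γ
sound (•₂-pull {Γ = Γ} d) = ⊨-left Γ λ { (i ,, (.jay $S i₂)) Δ k →
  •₂-pull {Γ = Δ} (k (sound d) (jay $S ((two $S i) ,, i₂))) }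
sound (•₂-push {Γ = Γ} d) = ⊨-left Γ λ { (.jay $S ((.two $S i) ,, i₂)) Δ k →
  •₂-push {Γ = Δ} (k (sound d) (i ,, (jay $S i₂))) }
sound (∘α∘₂-intro {Γ = Γ} d) = ⊨-left Γ λ { (.alpha $S (.two $S i)) Δ k → ∘α∘₂-intro {Γ = Δ} (k (sound d) i) }
sound (∘α•₂-intro {Γ = Γ} d) = ⊨-left Γ λ { (.alpha $S (.jay $S i)) Δ k → ∘α•₂-intro {Γ = Δ} (k (sound d) i) }
sound (∘α-elim {Γ = Γ} d e) = ⊨-left Γ λ i Δ k →
  ∘α-elim {Γ = Δ} (k (sound d) (alpha $S (two $S i))) (k (sound e) (alpha $S (jay $S i)))
sound (∘₂∘α-intro {Γ = Γ} d) = ⊨-left Γ λ { (.two $S (.alpha $S i)) Δ k → ∘₂∘α-intro {Γ = Δ} (k (sound d) i) }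
sound (•₂∘α-intro {Γ = Γ} d) = ⊨-left Γ λ { (.jay $S (.alpha $S i)) Δ k → •₂∘α-intro {Γ = Δ} (k (sound d) i) }
sound (∘α-elim′ {Γ = Γ} d e) = ⊨-left Γ λ i Δ k →
  ∘α-elim′ {Γ = Δ} (k (sound d) (two $S (alpha $S i))) (k (sound e) (jay $S (alpha $S i)))
sound (dyadic {Γ = Γ} q dy 0≤q q≤1 n d) = ⊨-left Γ λ { (i ,, i₂) Δ k → dyadic-case i (∘α^-invert n i₂) Δ (k (sound d)) }
  where
  dyadic-case : ∀ {γ s t c} → Instance ε⟨ q ⟩ s → ∘α^-Instance n (γ ,, ε⟨ 1ℚ ℚ.- q ⟩) t →
                ∀ Δ → (∀ {γ′} → Instance γ γ′ → LJK ▷ Δ [ γ′ ] ⊢ c) → LJK ▷ Δ [ s ,, t ] ⊢ c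
  dyadic-case i (∘α^-inst (l ,, r)) Δ k
    with refl ← ε⟨⟩-rigid q i | refl ← ε⟨⟩-rigid (1ℚ ℚ.- q) r =
    dyadic {Γ = Δ} q dy 0≤q q≤1 n (k l)
-- The constants in the premise contain no formulas; `self` supplies the instance that leaves them
-- unchanged.
sound (halves {Γ = Γ} n 1≤n d) = ⊨-left Γ λ i Δ k → halves-case i Δ (k (sound d) (self _))
  where
  halves-case : ∀ {s c} → Instance ε⟨ 1 /2^ (n ℕ.∸ 1) ⟩ s →
                ∀ Δ → LJK ▷ Δ [ ε⟨ 1 /2^ n ⟩ ,, ε⟨ 1 /2^ n ⟩ ] ⊢ c → LJK ▷ Δ [ s ] ⊢ c
  halves-case i Δ d with refl ← ε⟨⟩-rigid (1 /2^ (n ℕ.∸ 1)) i = halves {Γ = Δ} n 1≤n d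
sound (limit {Γ = Γ} d) = ⊨-left Γ λ { ε Δ k → limit {Γ = Δ} λ n → k (sound (d n)) (self _) }
sound (cover {Γ = Γ} n d) = ⊨-left Γ λ { (i ,, i₂) Δ k → cover-case i i₂ Δ λ l 1≤l l≤ →
    k (sound (d l 1≤l l≤)) (self _ ,, ∘α^-instance (suc n) (i ,, self _)) }
  where
  cover-case : ∀ {γ γ′ s c} → Instance γ γ′ → Instance ε⟨ 1 /2^ n ⟩ s → ∀ Δ →
               (∀ k → 1 ℕ.≤ k → k ℕ.≤ 2 ^ suc n ℕ.∸ 2 →
                 LJK ▷ Δ [ ε⟨ 1ℚ ℚ.- k /2^ suc n ⟩
                           ,, ∘α^ (suc n) (γ′ ,, ε⟨ k /2^ suc n ⟩) ] ⊢ c) →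
               LJK ▷ Δ [ γ′ ,, s ] ⊢ c
  cover-case i i₂ Δ d with refl ← ε⟨⟩-rigid (1 /2^ n) i₂ = cover {Γ = Δ} n d
-- No induction on the cut formula: the left premise puts each instance of `γ` into `⟦ a ⟧`, which
-- makes it an instance of the leaf `↑ a`.
sound (cut {Γ = Γ} d e) = ⊨-replace Γ (λ i → ↑ holds (sound d) i) (sound e)

theorem2 : (V : Set) (n : ℕ) (a : Fin n → Formula V) (b : Formula V) (G : Term (Fin n)) →
    LJK+cut ▷ G ⟪ a ⟫ ⊢ b →
    LJK ▷ G ⟪ a ⟫ ⊢ b
theorem2 V n a b G d = reify b (holds (sound d) (self (G ⟪ a ⟫)))
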